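{- Let $G$ be a finite graph and $k>0$ an integer, and let $\mathcal B_k^*$ be any uncrossing of $\mathcal B_k\cap2^{\vec S_k}$ (with respect to $\vec S=\vec S_k$). Then exactly one of the following holds: (i) $G$ contains a $k$-block; (ii) $G$ has an $S_k$-tree over $\overline{\mathcal B_k^*}$.
   Context: Separations of $G=(V,E)$: sets $\{A,B\}$ with $A\cup B=V$ and no edge between $A\setminus B$ and $B\setminus A$; orientations $(A,B),(B,A)$. The set $\vec U$ of oriented separations is ordered by $(A,B)\le(C,D)$ iff $A\subseteq C$, $B\supseteq D$, with involution $(A,B)^*=(B,A)$, join $(A\cup C,B\cap D)$, meet $(A\cap C,B\cup D)$; write $\overleftarrow s:=\vec s^{\,*}$. Order of $(A,B)$: $|A\cap B|$; $\vec S_k$: oriented separations of order $<k$; $S_k$ the corresponding separations. $\mathcal B_k$: all sets $\{(A_i,B_i):i\in I\}\subseteq\vec U$ with $|\bigcap_{i\in I}B_i|<k$. $k$-block: a maximal set $I$ of at least $k$ vertices such that no set $Z$ of fewer than $k$ vertices separates two vertices of $I\setminus Z$. Degenerate: $\vec s=\overleftarrow s$; small: $\vec s\le\overleftarrow s$; $\vec r\in\vec S$ trivial in $\vec S$: $\vec r<\vec s$ and $\vec r<\overleftarrow s$ for some $\vec s\in\vec S$; star: a set of nondegenerate oriented separations with $\vec r\le\overleftarrow s$ for all distinct members. Uncrossing (for $\vec S=\vec S_k$): replacing two members $\vec x_1,\vec x_2$ of $\sigma\subseteq\vec S$ by $\{\vec x_1\wedge\overleftarrow x_2,\vec x_2\}$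 (if $\vec x_1\wedge\overleftarrow x_2\in\vec S$) or by $\{\vec x_1,\vec x_2\wedge\overleftarrow x_1\}$ (if $\vec x_2\wedge\overleftarrow x_1\in\vec S$); a star obtained from $\sigma$ by finitely many such steps is obtained by uncrossing $\sigma$; an uncrossing of $\mathcal F\subseteq2^{\vec S}$ is a family $\mathcal F^*$ of stars, each obtained by uncrossing some member of $\mathcal F$, such that every member of $\mathcal F$ has some element of $\mathcal F^*$ obtained by uncrossing it. Shifting: for nontrivial nondegenerate $\vec r\in\vec S$, $\vec S_{\ge\vec r}$ is the set of orientations of separations in $S$ having an orientation $\ge\vec r$ (for $x\ne r$ exactly one, $\vec x$); for $\vec s\ge\vec r$ in $\vec S$ define $f^{\vec r}_{\vec s}$ on $\vec S_{\ge\vec r}\setminus\{\overleftarrow r\}$ by $f(\vec x)=\vec x\vee\vec s$, $f(\overleftarrow x)=(\vec x\vee\vec s)^*$; $\vec s$ emulates $\vec r$ in $\vec S$ if the image lies in $\vec S$; then for a star $\tau\subseteq\vec S_{\ge\vec r}\setminus\{\overleftarrow r\}$ containing some $\vec x\ge\vec r$, $f^{\vec r}_{\vec s}(\tau)$ is the shift of $\tau$ from $\vec r$ to $\vec s$. $\mathcal F$ forces $\vec r$ if $\{\overleftarrow r\}\in\mathcal F$. With $\mathcal F=\mathcal B_k\cap2^{\vec S_k}$: $\mathcal G_0=\mathcal F^*$, $\mathcal G_{n+1}$ = shifts of members of $\mathcal G_n$ from nontrivial nondegenerate $\vec r$ not forced by $\mathcal F$ to some $\vec s$ emulating $\vec r$;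 $\widehat{\mathcal F^*}=\bigcup_n\mathcal G_n$; $\overline{\mathcal F^*}=\widehat{\mathcal F^*}\cup\{\{\vec x\}:\vec x\in\vec S,\overleftarrow x\text{ small}\}$. An $S_k$-tree over $\mathcal H$ is a tree $T$ with a map $\alpha$ from oriented edges of $T$ to $\vec S_k$ such that $\alpha(t_2,t_1)=\alpha(t_1,t_2)^*$ and $\{\alpha(t',t):(t',t)\text{ oriented edge}\}\in\mathcal H$ for every node $t$. -}

module Defs where

open import Data.Nat using (ℕ; zero; suc; _<_; _≤_)
open import Data.Bool using (Bool; true; false)
open import Data.Fin using (Fin; toℕ) renaming (suc to fsuc)
open import Data.Fin.Subset using (Subset; _∈_; _∉_; _⊆_; _∩_; _∪_; ⊤; ∣_∣)
open import Data.List using (List; []; _∷_; foldr)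
open import Data.List.Membership.Propositional using () renaming (_∈_ to _∈ˡ_)
open import Data.List.Relation.Unary.All using (All)
open import Data.List.Relation.Binary.Pointwise using (Pointwise)
open import Data.Product using (Σ; ∃; ∃-syntax; _×_; _,_; proj₁; proj₂)
open import Data.Sum using (_⊎_)
open import Relation.Binary.PropositionalEquality using (_≡_; _≢_)
open import Relation.Binary.Construct.Closure.ReflexiveTransitive using (Star)
open import Relation.Nullary using (¬_)
open import Function.Bundles using (_⇔_)

record Graph (n : ℕ) : Set where
  field
    adj    : Fin n → Fin n → Bool
    sym    : ∀ x y → adj x y ≡ adj y x
    irrefl : ∀ x → adj x x ≡ false
open Graph public

module _ {n : ℕ} (G : Graph n) where

  OSep : Set
  OSep = Subset n × Subset n

  IsSep : OSep → Set
  IsSep (A , B) =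
    (∀ x → x ∈ A ⊎ x ∈ B) ×
    (∀ x y → x ∈ A → x ∉ B → y ∈ B → y ∉ A → adj G x y ≡ false)

  order : OSep → ℕ
  order (A , B) = ∣ A ∩ B ∣

  InS : ℕ → OSep → Set
  InS k s = IsSep s × order s < k

  _* : OSep → OSep
  (A , B) * = (B , A)

  _≤ₛ_ : OSep → OSep → Set
  (A , B) ≤ₛ (C , D) = A ⊆ C × D ⊆ B

  _<ₛ_ : OSep → OSep → Set
  r <ₛ s = r ≤ₛ s × r ≢ s

  _∨ₛ_ : OSep → OSep → OSep
  (A , B) ∨ₛ (C , D) = (A ∪ C , B ∩ D)

  _∧ₛ_ : OSep → OSep → OSep
  (A , B) ∧ₛ (C , D) = (A ∩ C , B ∪ D)

  Degenerate : OSep → Set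
  Degenerate s = s ≡ s *

  Small : OSep → Set
  Small s = s ≤ₛ (s *)

  Trivial : ℕ → OSep → Set
  Trivial k r = ∃[ s ] (InS k s × r <ₛ s × r <ₛ (s *))

  -- Finite sets of oriented separations are represented by lists,
  -- read as sets (duplicates and order irrelevant).

  _≋_ : List OSep → List OSep → Set
  σ ≋ τ = ∀ z → (z ∈ˡ σ) ⇔ (z ∈ˡ τ)

  IsStar : List OSep → Set
  IsStar σ = All (λ s → ¬ Degenerate s) σ ×
             (∀ r s → r ∈ˡ σ → s ∈ˡ σ → r ≢ s → r ≤ₛ (s *))

  ⋂B : List OSep → Subset n
  ⋂B = foldr (λ s acc → proj₂ s ∩ acc) ⊤

  InF : ℕ → List OSep → Set
  InF k σ = All (InS k) σ × ∣ ⋂B σ ∣ < k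

  -- Uncrossing (with respect to S⃗ = S⃗_k).
  -- One step: for two distinct members a , b of σ with a ∧ b* ∈ S⃗_k,
  -- replace a by a ∧ b*.  (Both variants of the paper are instances,
  -- with (a , b) = (x₁ , x₂) resp. (x₂ , x₁).)
  UncrossStep : ℕ → List OSep → List OSep → Set
  UncrossStep k σ σ' =
    ∃[ a ] ∃[ b ] (a ∈ˡ σ × b ∈ˡ σ × a ≢ b × InS k (a ∧ₛ (b *)) ×
      (∀ z → (z ∈ˡ σ') ⇔ ((z ∈ˡ σ × z ≢ a) ⊎ z ≡ a ∧ₛ (b *))))

  ObtainedByUncrossing : ℕ → List OSep → List OSep → Set
  ObtainedByUncrossing k σ τ = Star (UncrossStep k) σ τ × IsStar τ

  IsUncrossing : ℕ → (List OSep → Set) → Set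
  IsUncrossing k F* =
    (∀ τ → F* τ → ∃[ σ ] (InF k σ × ObtainedByUncrossing k σ τ)) ×
    (∀ σ → InF k σ → ∃[ τ ] (F* τ × ObtainedByUncrossing k σ τ))

  InS≥ : ℕ → OSep → OSep → Set
  InS≥ k r x = InS k x × (r ≤ₛ x ⊎ r ≤ₛ (x *))

  -- w = f^r_s(z) for z ∈ S⃗_{≥ r} ∖ {r*}:
  -- f(x⃗) = x⃗ ∨ s for the orientation x⃗ ≥ r, and f(x⃖) = (x⃗ ∨ s)*.
  ShiftVal : OSep → OSep → OSep → OSep → Set
  ShiftVal r s z w =
    (r ≤ₛ z × w ≡ z ∨ₛ s) ⊎ (¬ (r ≤ₛ z) × w ≡ ((z *) ∨ₛ s) *)

  Emulates : ℕ → OSep → OSep → Set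
  Emulates k s r =
    InS k s × r ≤ₛ s ×
    (∀ z w → InS≥ k r z → z ≢ r * → ShiftVal r s z w → InS k w)

  IsShift : ℕ → OSep → OSep → List OSep → List OSep → Set
  IsShift k r s τ τ' =
    IsStar τ ×
    All (λ z → InS≥ k r z × z ≢ r *) τ ×
    (∃[ x ] (x ∈ˡ τ × r ≤ₛ x)) ×
    Pointwise (ShiftVal r s) τ τ'

  Forces : ℕ → OSep → Set
  Forces k r = InF k ((r *) ∷ [])

  data Hat (k : ℕ) (F* : List OSep → Set) : List OSep → Set where
    base  : ∀ {τ} → F* τ → Hat k F* τ
    shift : ∀ {τ τ'} r s →
            Hat k F* τ →
            InS k r → ¬ Trivial k r → ¬ Degenerate r → ¬ Forces k r →
            Emulates k s r →
            IsShift k r s τ τ' →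
            Hat k F* τ'

  Closure : ℕ → (List OSep → Set) → List OSep → Set
  Closure k F* τ =
    Hat k F* τ ⊎ (∃[ x ] (InS k x × Small (x *) × τ ≡ x ∷ []))

  InClosure : ℕ → (List OSep → Set) → (OSep → Set) → Set
  InClosure k F* P = ∃[ τ ] (Closure k F* τ × (∀ z → (z ∈ˡ τ) ⇔ P z))

  -- S_k-trees over \overline{𝓕*}.
  -- A finite tree is given by nodes Fin (suc m), node 0 the root, and
  -- for each i : Fin m an edge e_i between node (fsuc i) and its parent
  -- (parent i), where parent i has smaller index.  Every finite tree is
  -- isomorphic to one of this form.

  data Dir : Set where
    up down : Dir   -- up: (fsuc i , parent i);  down: (parent i , fsuc i)

  record STree (k : ℕ) (F* : List OSep → Set) : Set where
    field
      m        : ℕ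
      parent   : Fin m → Fin (suc m)
      parent<  : ∀ i → toℕ (parent i) ≤ toℕ i
      α        : Fin m → Dir → OSep
      α-inv    : ∀ i → α i down ≡ (α i up) *
      α-S      : ∀ i d → InS k (α i d)
      -- {α(t',t) : (t',t) oriented edge} ∈ \overline{𝓕*} for each node t
      nodes-ok : ∀ (t : Fin (suc m)) → InClosure k F* (λ z →
                   ∃[ i ] ((parent i ≡ t × z ≡ α i up) ⊎
                           (fsuc i ≡ t × z ≡ α i down)))

  HasTree : ℕ → (List OSep → Set) → Set
  HasTree k F* = STree k F*

  data Reach (Z : Subset n) : Fin n → Fin n → Set where
    here : ∀ {x} → x ∉ Z → Reach Z x x
    step : ∀ {x y z} → x ∉ Z → adj G x y ≡ true → Reach Z y z → Reach Z x z

  Inseparable : ℕ → Subset n → Set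
  Inseparable k I = ∀ Z → ∣ Z ∣ < k → ∀ x y → x ∈ I → y ∈ I → x ∉ Z → y ∉ Z →
                    Reach Z x y

  IsBlock : ℕ → Subset n → Set
  IsBlock k I = k ≤ ∣ I ∣ × Inseparable k I ×
                (∀ J → I ⊆ J → Inseparable k J → J ⊆ I)

  HasBlock : ℕ → Set
  HasBlock k = ∃[ I ] IsBlock k I

{-# OPTIONS --safe #-}
module Submission where

-- Call a separation light if its first side has fewer than k vertices; all small, all trivial and
-- all forced separations are light.  If P is a down-closed set containing all light separations,
-- then there is a k-block or a tree over the shifts of 𝓑_k* and the stars {x*} with x ∈ P.  This
-- is shown by adding separations to P.  If P contains an orientation of every separation, then
-- either its sides B_i have at least k common vertices, and these form a k-block, or P itself lies
-- in 𝓑_k and contains the star obtained by uncrossing it.  Otherwise there are r₁ ≤ r and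
-- r₂ ≤ r*, minimal outside P, for some r which P does not orient.  A separation s of minimum order
-- with r₁ ≤ s ≤ r₂* emulates r₁, and s* emulates r₂, by submodularity; the trees obtained for
-- P ∪ {r₁} and P ∪ {r₂} are shifted to s and s* and glued along s.
--
-- Conversely, a block orients every separation of S_k towards itself.  The edges of a tree, oriented
-- in this way, have a sink, whose star can be traced back through shifts and uncrossings to a
-- member of 𝓑_k contained in the orientation, which is absurd.

open import Defs
open import Data.Bool using (Bool; true; false; _∧_; _∨_)
import Data.Bool.Properties as Bool
open import Data.Nat using (ℕ; zero; suc; _+_; _≤_; _<_; _≤?_; _<?_; z≤n; s≤s)
open import Data.Nat.Properties
  using (+-commutativeSemigroup; +-suc; +-mono-≤; +-mono-<-≤; +-mono-≤-<; +-monoʳ-≤; +-cancelʳ-≤;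
         ≤-trans; <-trans; <-≤-trans; ≤-<-trans; ≤-pred; <⇒≱; ≮⇒≥; ≰⇒>; n<1+n;
         module ≤-Reasoning)
open import Data.Nat.Induction using (<-wellFounded)
open import Induction.WellFounded using (Acc; acc)
open import Data.Fin using (Fin; zero; suc; toℕ; splitAt; _↑ˡ_; _↑ʳ_)
import Data.Fin.Properties as Fin
open import Data.Fin.Subset using (Subset; _∈_; _∉_; _⊆_; _∩_; _∪_; ∁; ⊤; ⁅_⁆; ∣_∣; inside; outside)
open import Data.Fin.Subset.Properties
open import Data.Vec using ([]; _∷_)
import Data.Vec.Properties as Vec
open import Data.List using (List; []; _∷_; _++_; map; filter; length; cartesianProduct)
import Data.List.Properties as List
open import Data.List.Membership.Propositional using (lose) renaming (_∈_ to _∈ˡ_)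
open import Data.List.Membership.Propositional.Properties
  using (∈-map⁺; ∈-map⁻; ∈-++⁺ˡ; ∈-++⁺ʳ; ∈-++⁻; ∈-filter⁺; ∈-filter⁻; ∈-cartesianProduct⁺)
open import Data.List.Relation.Unary.All as All using (All; []; _∷_)
open import Data.List.Relation.Unary.Any as Any using (Any; here; there)
open import Data.List.Relation.Binary.Pointwise using (Pointwise; []; _∷_)
open import Data.Product using (∃; ∃-syntax; _×_; _,_; proj₁; proj₂; map₁; map₂)
import Data.Product.Properties as Prod
open import Data.Sum using (_⊎_; inj₁; inj₂; [_,_]′)
open import Data.Empty using (⊥; ⊥-elim)
open import Function using (_∘_; id)
open import Function.Bundles using (_⇔_; mk⇔; Equivalence)
open import Relation.Nullary using (¬_; Dec; yes; no; contradiction; ¬?; _×-dec_; _⊎-dec_; _→-dec_)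
open import Relation.Nullary.Decidable using (decidable-stable; map′)
open import Relation.Unary using (Decidable)
open import Relation.Binary.PropositionalEquality
  using (_≡_; _≢_; refl; trans; cong; cong₂; subst; subst₂)
  renaming (sym to ≡-sym)
open import Relation.Binary.Construct.Closure.ReflexiveTransitive using (Star; ε; _◅_)

open import Algebra.Properties.CommutativeSemigroup +-commutativeSemigroup using (interchange)

open Equivalence using (to; from)

-- Lists and finite index sets.

-- `B` serves as an early exit: a construction applied to all elements of a star is abandoned as
-- soon as one of them yields `B`.
all-or : ∀ {A B : Set} {P : A → Set} (xs : List A) →
         (∀ x → x ∈ˡ xs → P x ⊎ B) → (∀ x → x ∈ˡ xs → P x) ⊎ B
all-or []       h = inj₁ λ _ ()
all-or (x ∷ xs) h with h x (here refl) | all-or xs (λ y → h y ∘ there)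
... | inj₂ b | _      = inj₂ b
... | inj₁ _ | inj₂ b = inj₂ b
... | inj₁ p | inj₁ q = inj₁ λ { _ (here refl) → p ; y (there m) → q y m }

last : ∀ {m} {P : Fin m → Set} → Decidable P →
       (∀ i → ¬ P i) ⊎ (∃[ i ] (P i × (∀ j → toℕ i < toℕ j → ¬ P j)))
last {zero}  P? = inj₁ λ ()
last {suc m} P? with last (λ i → P? (suc i)) | P? zero
... | inj₂ (i , p , later) | _ = inj₂ (suc i , p , λ { (suc j) (s≤s i<j) → later j i<j })
... | inj₁ none | yes p = inj₂ (zero , p , λ { (suc j) _ → none j })
... | inj₁ none | no ¬p = inj₁ λ { zero → ¬p ; (suc i) → none i }

pointwise-∈ʳ : ∀ {A : Set} {R : A → A → Set} {xs ys y} → Pointwise R xs ys → y ∈ˡ ys →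
               ∃[ x ] (x ∈ˡ xs × R x y)
pointwise-∈ʳ (r ∷ rs) (here refl) = _ , here refl , r
pointwise-∈ʳ (r ∷ rs) (there m)   = map₂ (map₁ there) (pointwise-∈ʳ rs m)

pointwise-∈ˡ : ∀ {A : Set} {R : A → A → Set} {xs ys x} → Pointwise R xs ys → x ∈ˡ xs →
               ∃[ y ] (y ∈ˡ ys × R x y)
pointwise-∈ˡ (r ∷ rs) (here refl) = _ , here refl , r
pointwise-∈ˡ (r ∷ rs) (there m)   = map₂ (map₁ there) (pointwise-∈ˡ rs m)

pointwise-map : ∀ {A : Set} {R : A → A → Set} {f : A → A} → (∀ x → R x (f x)) →
                ∀ xs → Pointwise R xs (map f xs)
pointwise-map h []       = []
pointwise-map h (x ∷ xs) = h x ∷ pointwise-map h xs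

-- Submodularity of the order.

bit : Bool → ℕ
bit true  = 1
bit false = 0

∣∷∣ : ∀ {n} b (p : Subset n) → ∣ b ∷ p ∣ ≡ bit b + ∣ p ∣
∣∷∣ true  p = refl
∣∷∣ false p = refl

-- The contribution of one vertex, whose membership in `A`, `B`, `C`, `D` is given by the four bits.
-- It is strict exactly when one pair contains the vertex twice and the other misses it.
bit-submodular : ∀ a b c d →
  bit ((a ∨ c) ∧ (b ∧ d)) + bit ((a ∧ c) ∧ (b ∨ d)) ≤ bit (a ∧ b) + bit (c ∧ d)
bit-submodular true  true  true  true  = s≤s (s≤s z≤n)
bit-submodular true  true  true  false = s≤s z≤n
bit-submodular true  true  false true  = s≤s z≤n
bit-submodular true  true  false false = z≤n
bit-submodular true  false true  true  = s≤s z≤n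
bit-submodular true  false true  false = z≤n
bit-submodular true  false false true  = z≤n
bit-submodular true  false false false = z≤n
bit-submodular false true  true  true  = s≤s z≤n
bit-submodular false true  true  false = z≤n
bit-submodular false true  false true  = z≤n
bit-submodular false true  false false = z≤n
bit-submodular false false true  true  = z≤n
bit-submodular false false true  false = z≤n
bit-submodular false false false true  = z≤n
bit-submodular false false false false = z≤n

∣∩∣-submodular : ∀ {n} (A B C D : Subset n) →
  ∣ (A ∪ C) ∩ (B ∩ D) ∣ + ∣ (A ∩ C) ∩ (B ∪ D) ∣ ≤ ∣ A ∩ B ∣ + ∣ C ∩ D ∣
∣∩∣-submodular [] [] [] [] = z≤n
∣∩∣-submodular (a ∷ A) (b ∷ B) (c ∷ C) (d ∷ D) = begin
  ∣ ((a ∷ A) ∪ (c ∷ C)) ∩ ((b ∷ B) ∩ (d ∷ D)) ∣ + ∣ ((a ∷ A) ∩ (c ∷ C)) ∩ ((b ∷ B) ∪ (d ∷ D)) ∣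
    ≡⟨ cong₂ _+_ (∣∷∣ ((a ∨ c) ∧ (b ∧ d)) ((A ∪ C) ∩ (B ∩ D)))
                 (∣∷∣ ((a ∧ c) ∧ (b ∨ d)) ((A ∩ C) ∩ (B ∪ D))) ⟩
  (x + X) + (y + Y)
    ≡⟨ interchange x X y Y ⟩
  (x + y) + (X + Y)
    ≤⟨ +-mono-≤ (bit-submodular a b c d) (∣∩∣-submodular A B C D) ⟩
  (bit (a ∧ b) + bit (c ∧ d)) + (∣ A ∩ B ∣ + ∣ C ∩ D ∣)
    ≡⟨ interchange (bit (a ∧ b)) (bit (c ∧ d)) ∣ A ∩ B ∣ ∣ C ∩ D ∣ ⟩
  (bit (a ∧ b) + ∣ A ∩ B ∣) + (bit (c ∧ d) + ∣ C ∩ D ∣)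
    ≡⟨ cong₂ _+_ (∣∷∣ (a ∧ b) (A ∩ B)) (∣∷∣ (c ∧ d) (C ∩ D)) ⟨
  ∣ (a ∷ A) ∩ (b ∷ B) ∣ + ∣ (c ∷ C) ∩ (d ∷ D) ∣ ∎
  where
  open ≤-Reasoning
  x = bit ((a ∨ c) ∧ (b ∧ d))
  y = bit ((a ∧ c) ∧ (b ∨ d))
  X = ∣ (A ∪ C) ∩ (B ∩ D) ∣
  Y = ∣ (A ∩ C) ∩ (B ∪ D) ∣

-- Cardinality and enumeration of subsets.

card-mono : ∀ {n} (p q : Subset n) → p ⊆ q → ∣ p ∣ ≤ ∣ q ∣
card-mono p q = p⊆q⇒∣p∣≤∣q∣

⊆-full⇒≡ : ∀ {n} {p q : Subset n} → p ⊆ q → ∣ q ∣ ≤ ∣ p ∣ → p ≡ q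
⊆-full⇒≡ {p = p} {q} p⊆q q≤p = ⊆-antisym p⊆q λ {x} x∈q →
  decidable-stable (x ∈? p) λ x∉p → <⇒≱ (p⊂q⇒∣p∣<∣q∣ (p⊆q , x , x∈q , x∉p)) q≤p

subsets : ∀ n → List (Subset n)
subsets zero    = [] ∷ []
subsets (suc n) = map (inside ∷_) (subsets n) ++ map (outside ∷_) (subsets n)

∈-subsets : ∀ {n} (p : Subset n) → p ∈ˡ subsets n
∈-subsets []            = here refl
∈-subsets (inside ∷ p)  = ∈-++⁺ˡ (∈-map⁺ (inside ∷_) (∈-subsets p))
∈-subsets (outside ∷ p) = ∈-++⁺ʳ _ (∈-map⁺ (outside ∷_) (∈-subsets p))

-- The lattice of oriented separations.

module Separations {n : ℕ} (G : Graph n) where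

  Sep : Set
  Sep = OSep G

  infix 4 _⊑_ _⊑?_ _≟_ _∈ˡ?_
  infixr 6 _⊔_ _⊓_

  _⊑_ : Sep → Sep → Set
  _⊑_ = _≤ₛ_ G

  _⊔_ : Sep → Sep → Sep
  _⊔_ = _∨ₛ_ G

  _⊓_ : Sep → Sep → Sep
  _⊓_ = _∧ₛ_ G

  inv : Sep → Sep
  inv = _* G

  _≟_ : (r s : Sep) → Dec (r ≡ s)
  _≟_ = Prod.≡-dec (Vec.≡-dec Bool._≟_) (Vec.≡-dec Bool._≟_)

  _∈ˡ?_ : (r : Sep) (σ : List Sep) → Dec (r ∈ˡ σ)
  r ∈ˡ? σ = Any.any? (r ≟_) σ

  _⊑?_ : (r s : Sep) → Dec (r ⊑ s)
  (A , B) ⊑? (C , D) = (A ⊆? C) ×-dec (D ⊆? B)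

  ⊑-refl : ∀ s → s ⊑ s
  ⊑-refl s = id , id

  ⊑-trans : ∀ r s t → r ⊑ s → s ⊑ t → r ⊑ t
  ⊑-trans r s t (p , q) (p′ , q′) = (λ m → p′ (p m)) , (λ m → q (q′ m))

  ⊑-antisym : ∀ r s → r ⊑ s → s ⊑ r → r ≡ s
  ⊑-antisym r s (p , q) (p′ , q′) = cong₂ _,_ (⊆-antisym p p′) (⊆-antisym q′ q)

  ⊑-⊔ˡ : ∀ r s → r ⊑ r ⊔ s
  ⊑-⊔ˡ (A , B) (C , D) = p⊆p∪q C , p∩q⊆p B D

  ⊑-⊔ʳ : ∀ r s → s ⊑ r ⊔ s
  ⊑-⊔ʳ (A , B) (C , D) = q⊆p∪q A C , p∩q⊆q B D

  ⊔-least : ∀ r s t → r ⊑ t → s ⊑ t → r ⊔ s ⊑ t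
  ⊔-least (A , B) (C , D) _ (p , q) (p′ , q′) =
    (λ m → [ p , p′ ]′ (x∈p∪q⁻ A C m)) , (λ m → x∈p∩q⁺ (q m , q′ m))

  inv-⊑ : ∀ r s → r ⊑ s → inv s ⊑ inv r
  inv-⊑ r s (p , q) = q , p

  IsSep? : ∀ s → Dec (IsSep G s)
  IsSep? (A , B) =
    Fin.all? (λ x → (x ∈? A) ⊎-dec (x ∈? B)) ×-dec
    Fin.all? (λ x → Fin.all? λ y → (x ∈? A) →-dec (¬? (x ∈? B) →-dec
      ((y ∈? B) →-dec (¬? (y ∈? A) →-dec (adj G x y Bool.≟ false)))))

  InS? : ∀ k s → Dec (InS G k s)
  InS? k s = IsSep? s ×-dec (order G s <? k)

  IsSep-inv : ∀ s → IsSep G s → IsSep G (inv s)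
  IsSep-inv s (cover , cut) =
    (λ x → [ inj₂ , inj₁ ]′ (cover x)) ,
    (λ x y x∈B x∉A y∈A y∉B → trans (Graph.sym G x y) (cut y x y∈A y∉B x∈B x∉A))

  order-inv : ∀ s → order G (inv s) ≡ order G s
  order-inv (A , B) = cong ∣_∣ (∩-comm B A)

  InS-inv : ∀ k s → InS G k s → InS G k (inv s)
  InS-inv k s (p , q) = IsSep-inv s p , subst (_< k) (≡-sym (order-inv s)) q

  IsSep-⊔ : ∀ r s → IsSep G r → IsSep G s → IsSep G (r ⊔ s)
  IsSep-⊔ (A , B) (C , D) (cov₁ , cut₁) (cov₂ , cut₂) = cover , cut
    where
    cover : ∀ x → x ∈ A ∪ C ⊎ x ∈ B ∩ D
    cover x with cov₁ x | cov₂ x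
    ... | inj₁ a | _      = inj₁ (x∈p∪q⁺ (inj₁ a))
    ... | inj₂ _ | inj₁ c = inj₁ (x∈p∪q⁺ (inj₂ c))
    ... | inj₂ b | inj₂ d = inj₂ (x∈p∩q⁺ (b , d))
    cut : ∀ x y → x ∈ A ∪ C → x ∉ B ∩ D → y ∈ B ∩ D → y ∉ A ∪ C → adj G x y ≡ false
    cut x y _ x∉ y∈ y∉ with x∈p∩q⁻ B D y∈ | cov₁ x | cov₂ x | x ∈? B | x ∈? D
    ... | b , d | inj₁ a | _      | no ¬b | _     = cut₁ x y a ¬b b (y∉ ∘ x∈p∪q⁺ ∘ inj₁)
    ... | b , d | inj₂ b′ | _     | no ¬b | _     = contradiction b′ ¬b
    ... | b , d | _ | inj₁ c      | yes _ | no ¬d = cut₂ x y c ¬d d (y∉ ∘ x∈p∪q⁺ ∘ inj₂)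
    ... | b , d | _ | inj₂ d′     | yes _ | no ¬d = contradiction d′ ¬d
    ... | b , d | _ | _           | yes p | yes q = contradiction (x∈p∩q⁺ (p , q)) x∉

  IsSep-⊓ : ∀ r s → IsSep G r → IsSep G s → IsSep G (r ⊓ s)
  IsSep-⊓ r s p q =
    IsSep-inv _ (IsSep-⊔ (inv r) (inv s) (IsSep-inv r p) (IsSep-inv s q))

  -- The first side of `r` lies in the separator of `s`. Hence above a separation that is not light
  -- there is at most one orientation of each member of S_k.
  ⊑-both⇒light : ∀ k r s → InS G k s → r ⊑ s → r ⊑ inv s → ∣ proj₁ r ∣ < k
  ⊑-both⇒light k r s (_ , s<k) (p , _) (q , _) =
    ≤-<-trans (p⊆q⇒∣p∣≤∣q∣ (λ m → x∈p∩q⁺ (p m , q m))) s<k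

  seps : List Sep
  seps = cartesianProduct (subsets n) (subsets n)

  ∈-seps : ∀ s → s ∈ˡ seps
  ∈-seps (A , B) = ∈-cartesianProduct⁺ (∈-subsets A) (∈-subsets B)

  anySep? : {P : Sep → Set} → Decidable P → Dec (∃ P)
  anySep? {P} P? = map′ Any.satisfied (λ (s , p) → lose (∈-seps s) p) (Any.any? P? seps)

  minimal : {Q : Sep → Set} → Decidable Q → (f : Sep → ℕ) → ∀ x → Q x →
            ∃[ y ] (Q y × (∀ z → Q z → f y ≤ f z))
  minimal {Q} Q? f x q = go x q (<-wellFounded (f x))
    where
    go : ∀ x → Q x → Acc _<_ (f x) → ∃[ y ] (Q y × (∀ z → Q z → f y ≤ f z))
    go x q (acc rs) with anySep? (λ z → Q? z ×-dec (f z <? f x))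
    ... | yes (z , q′ , z<x) = go z q′ (rs z<x)
    ... | no ¬lower = x , q , λ z q′ → ≮⇒≥ λ z<x → ¬lower (z , q′ , z<x)

  -- The complement is taken because second sides shrink as separations grow; thus `rank` is
  -- strictly monotone, and its minimisers are minimal in the order.
  rank : Sep → ℕ
  rank (A , B) = ∣ A ∣ + ∣ ∁ B ∣

  rank-strict : ∀ r s → r ⊑ s → rank s ≤ rank r → r ≡ s
  rank-strict (A , B) (C , D) (A⊆C , D⊆B) le =
    cong₂ _,_ (⊆-full⇒≡ A⊆C C≤A)
              (∁-injective (⊆-full⇒≡ ∁B⊆∁D D≤B))
    where
    ∁B⊆∁D : ∁ B ⊆ ∁ D
    ∁B⊆∁D = p⊆q⇒∁p⊇∁q D⊆B
    C≤A : ∣ C ∣ ≤ ∣ A ∣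
    C≤A = ≮⇒≥ λ lt → <⇒≱ (+-mono-<-≤ lt (p⊆q⇒∣p∣≤∣q∣ ∁B⊆∁D)) le
    D≤B : ∣ ∁ D ∣ ≤ ∣ ∁ B ∣
    D≤B = ≮⇒≥ λ lt → <⇒≱ (+-mono-≤-< (p⊆q⇒∣p∣≤∣q∣ A⊆C) lt) le
    ∁-injective : ∁ B ≡ ∁ D → B ≡ D
    ∁-injective eq = ⊆-antisym
      (∁p⊆∁q⇒p⊇q (⊆-reflexive (≡-sym eq))) (∁p⊆∁q⇒p⊇q (⊆-reflexive eq))

  -- Reachability and blocks

  -- The first vertex of the walk in `B` would lie outside `A`, and so end an edge between the two
  -- strict sides.
  reach-avoids : ∀ s → IsSep G s → ∀ {x y} → Reach G (proj₁ s ∩ proj₂ s) x y →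
                 x ∉ proj₂ s → y ∉ proj₂ s
  reach-avoids (A , B) sep (here _) x∉B = x∉B
  reach-avoids (A , B) sep@(cover , cut) {x} (step {y = z} _ x~z z⇝y) x∉B =
    reach-avoids (A , B) sep z⇝y z∉B
    where
    start : ∀ {z y} → Reach G (A ∩ B) z y → z ∉ A ∩ B
    start (here p)     = p
    start (step p _ _) = p
    x∈A : x ∈ A
    x∈A = [ id , ⊥-elim ∘ x∉B ]′ (cover x)
    z∉B : z ∉ B
    z∉B z∈B with z ∈? A
    ... | yes z∈A = start z⇝y (x∈p∩q⁺ (z∈A , z∈B))
    ... | no z∉A  = contradiction (trans (≡-sym x~z) (cut x z x∈A x∉B z∈B z∉A)) λ ()

  -- Such a `C` is the vertex set of the component of `y` in G - Z. Having it as a `Subset` makes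
  -- reachability decidable.
  IsComponent : Subset n → Fin n → Subset n → Set
  IsComponent Z y C = y ∈ C × (∀ v → v ∈ C → Reach G Z v y) ×
                      (∀ v w → v ∈ C → w ∉ Z → adj G w v ≡ true → w ∈ C)

  -- Starting from `y`, neighbours outside `Z` are added one at a time; the complement shrinks until
  -- the set is closed.
  component : ∀ Z y → y ∉ Z → ∃ (IsComponent Z y)
  component Z y y∉Z =
    grow ⁅ y ⁆ (x∈⁅x⁆ y)
      (λ v v∈ → subst (λ v → Reach G Z v y) (≡-sym (x∈⁅y⁆⇒x≡y y v∈)) (here y∉Z))
      (<-wellFounded _)
    where
    grow : ∀ C → y ∈ C → (∀ v → v ∈ C → Reach G Z v y) → Acc _<_ ∣ ∁ C ∣ →
           ∃ (IsComponent Z y)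
    grow C y∈C reach (acc rs)
      with Fin.any? (λ w → ¬? (w ∈? C) ×-dec ¬? (w ∈? Z) ×-dec
                     Fin.any? (λ v → (v ∈? C) ×-dec (adj G w v Bool.≟ true)))
    ... | no closed = C , y∈C , reach , λ v w v∈C w∉Z w~v →
      decidable-stable (w ∈? C) λ w∉C → closed (w , w∉C , w∉Z , v , v∈C , w~v)
    ... | yes (w , w∉C , w∉Z , v , v∈C , w~v) =
      grow (C ∪ ⁅ w ⁆) (p⊆p∪q ⁅ w ⁆ y∈C)
        (λ u u∈ → [ reach u
                  , (λ u∈w → subst (λ u → Reach G Z u y) (≡-sym (x∈⁅y⁆⇒x≡y w u∈w))
                              (step w∉Z w~v (reach v v∈C))) ]′
                  (x∈p∪q⁻ C ⁅ w ⁆ u∈))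
        (rs (p⊂q⇒∣p∣<∣q∣ (p⊂q⇒∁p⊃∁q
          (p⊆p∪q ⁅ w ⁆ , w , q⊆p∪q C ⁅ w ⁆ (x∈⁅x⁆ w) , w∉C))))

  ∈-⋂B : ∀ O {x} → (∀ s → s ∈ˡ O → x ∈ proj₂ s) → x ∈ ⋂B G O
  ∈-⋂B []      h = ∈⊤
  ∈-⋂B (s ∷ O) h = x∈p∩q⁺ (h s (here refl) , ∈-⋂B O (λ t → h t ∘ there))

  ⋂B⊆ : ∀ {O s} → s ∈ˡ O → ⋂B G O ⊆ proj₂ s
  ⋂B⊆ {s ∷ O} (here refl) m = proj₁ (x∈p∩q⁻ (proj₂ s) _ m)
  ⋂B⊆ {s ∷ O} (there i)   m = ⋂B⊆ i (proj₂ (x∈p∩q⁻ (proj₂ s) _ m))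

  large⊈separator : ∀ {k} s I → InS G k s → k ≤ ∣ I ∣ → I ⊆ proj₁ s → ¬ I ⊆ proj₂ s
  large⊈separator s I (_ , s<k) k≤I I⊆A I⊆B =
    <⇒≱ s<k (≤-trans k≤I (p⊆q⇒∣p∣≤∣q∣ (λ m → x∈p∩q⁺ (I⊆A m , I⊆B m))))

  -- A vertex of `I` outside the first side would be separated from `v` by the separator, which has
  -- fewer than k vertices.
  inseparable-side : ∀ {k I} → Inseparable G k I → ∀ s → InS G k s → ∀ {v} →
                     v ∈ I → v ∉ proj₂ s → I ⊆ proj₁ s
  inseparable-side {k} {I} insep (A , B) (sep@(cover , _) , s<k) {v} v∈I v∉B {u} u∈I =
    decidable-stable (u ∈? A) λ u∉A →
      reach-avoids (A , B) sep
        (insep (A ∩ B) s<k v u v∈I u∈I (v∉B ∘ proj₂ ∘ x∈p∩q⁻ A B) (u∉A ∘ proj₁ ∘ x∈p∩q⁻ A B))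
        v∉B ([ ⊥-elim ∘ u∉A , id ]′ (cover u))

  orientation⇒block : ∀ {k} O → All (InS G k) O →
    (∀ s → InS G k s → s ∈ˡ O ⊎ inv s ∈ˡ O) → k ≤ ∣ ⋂B G O ∣ → HasBlock G k
  orientation⇒block {k} O O⊆S total k≤J = J , k≤J , insep , maximal
    where
    J : Subset n
    J = ⋂B G O

    insep : Inseparable G k J
    insep Z Z<k x y x∈J y∈J x∉Z y∉Z with component Z y y∉Z
    ... | C , y∈C , reach , closed with x ∈? C
    ...   | yes x∈C = reach x x∈C
    ...   | no x∉C  = ⊥-elim ([ left , right ]′ (total s s∈S))
      where
      -- `C` is the component of `y` without `x`, and the separator lies in `Z`. If `O` contains
      -- `s`, then `J` misses `C` and hence `y`; if it contains the inverse, then `J` lies in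
      -- `C ∪ Z`, which misses `x`.
      s : Sep
      s = C ∪ Z , ∁ C
      sep : IsSep G s
      sep = (λ v → [ inj₁ ∘ x∈p∪q⁺ ∘ inj₁ , inj₂ ∘ x∉p⇒x∈∁p ]′ (dec⊎ (v ∈? C))) ,
            λ v w _ v∉ _ w∉ → Bool.¬-not λ v~w →
              w∉ (x∈p∪q⁺ (inj₁ (closed v w (x∉∁p⇒x∈p v∉) (w∉ ∘ x∈p∪q⁺ ∘ inj₂)
                (trans (Graph.sym G w v) v~w))))
        where
        dec⊎ : ∀ {P : Set} → Dec P → P ⊎ ¬ P
        dec⊎ (yes p) = inj₁ p
        dec⊎ (no ¬p) = inj₂ ¬p
      separator⊆Z : (C ∪ Z) ∩ ∁ C ⊆ Z
      separator⊆Z m with x∈p∩q⁻ (C ∪ Z) (∁ C) m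
      ... | a , b = [ (λ c → contradiction b (x∈p⇒x∉∁p c)) , id ]′ (x∈p∪q⁻ C Z a)
      s∈S : InS G k s
      s∈S = sep , ≤-<-trans (p⊆q⇒∣p∣≤∣q∣ separator⊆Z) Z<k
      left : s ∈ˡ O → ⊥
      left m = x∈∁p⇒x∉p (⋂B⊆ m y∈J) y∈C
      right : inv s ∈ˡ O → ⊥
      right m = [ x∉C , x∉Z ]′ (x∈p∪q⁻ C Z (⋂B⊆ m x∈J))

    maximal : ∀ I → J ⊆ I → Inseparable G k I → I ⊆ J
    -- A vertex of `I` outside some second side of `O` pulls `I`, and with it `J`, into the first
    -- side; then `J` lies in a separator and is too small.
    maximal I J⊆I insepI {v} v∈I = ∈-⋂B O λ s m →
      decidable-stable (v ∈? proj₂ s) λ v∉B →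
        let s∈S = All.lookup O⊆S m
        in large⊈separator s J s∈S k≤J
             (λ j → inseparable-side insepI s s∈S v∈I v∉B (J⊆I j)) (⋂B⊆ m)

module _ {n : ℕ} (G : Graph n) (k : ℕ) (F* : List (OSep G) → Set)
         (unc : IsUncrossing G k F*) where

  open Separations G

  -- Uncrossings

  private
    S : Sep → Set
    S = InS G k
    H : List Sep → Set
    H = Hat G k F*

  -- For `s` in S_k this means precisely that `s` is forced, as the second side of its inverse is
  -- the first side of `s`.
  Light : Sep → Set
  Light s = ∣ proj₁ s ∣ < k

  uncross-singleton : ∀ {x τ} → ObtainedByUncrossing G k (x ∷ []) τ → τ ≡ x ∷ []
  uncross-singleton (ε , _) = refl
  uncross-singleton ((_ , _ , here refl , here refl , a≢b , _) ◅ _ , _) = contradiction refl a≢b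

  InF-singleton : ∀ {x} → InF G k (x ∷ []) → F* (x ∷ []) × IsStar G (x ∷ [])
  InF-singleton f with proj₂ unc _ f
  ... | τ , τ∈F* , obt with uncross-singleton obt
  ...   | refl = τ∈F* , proj₂ obt

  light⇒InF : ∀ {s} → S s → Light s → InF G k (inv s ∷ [])
  light⇒InF {s} s∈S s<k =
    InS-inv k s s∈S ∷ [] , ≤-<-trans (card-mono (proj₁ s ∩ ⊤) (proj₁ s) (p∩q⊆p (proj₁ s) ⊤)) s<k

  -- Otherwise {(V,V)} belongs to 𝓕, but uncrosses only to itself, which is not a star.
  k≤n : k ≤ ∣ ⊤ {n} ∣
  k≤n = ≮⇒≥ λ n<k → let v = ⊤ , ⊤ in
    All.head (proj₁ (proj₂ (InF-singleton
      (light⇒InF {v} (((λ _ → inj₁ ∈⊤) , λ _ _ _ x∉ _ _ → contradiction ∈⊤ x∉) ,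
                  ≤-<-trans (card-mono (⊤ {n} ∩ ⊤) ⊤ (p∩q⊆p ⊤ ⊤)) n<k) n<k)))) refl

  -- A degenerate separation is (V,V), whose order is at least k by `k≤n`.
  nondegenerate : ∀ s → S s → ¬ Degenerate G s
  nondegenerate s ((cover , _) , s<k) s≡s* =
    <⇒≱ s<k (≤-trans k≤n (card-mono ⊤ (proj₁ s ∩ proj₂ s) λ {x} _ →
      x∈p∩q⁺ ([ id , subst (x ∈_) (≡-sym (cong proj₁ s≡s*)) ]′ (cover x) ,
              [ subst (x ∈_) (cong proj₁ s≡s*) , id ]′ (cover x))))

  -- Shifting and emulation.

  ⊔-monoˡ : ∀ {x y} s → x ⊑ y → x ⊔ s ⊑ y ⊔ s
  ⊔-monoˡ {x} {y} s x⊑y = ⊔-least x s (y ⊔ s)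
    (⊑-trans x y (y ⊔ s) x⊑y (⊑-⊔ˡ y s)) (⊑-⊔ʳ y s)

  ShiftVal-functional : ∀ r s {z w w′} → ShiftVal G r s z w → ShiftVal G r s z w′ → w ≡ w′
  ShiftVal-functional r s (inj₁ (_ , e))  (inj₁ (_ , e′))  = trans e (≡-sym e′)
  ShiftVal-functional r s (inj₁ (p , _))  (inj₂ (¬p , _))  = contradiction p ¬p
  ShiftVal-functional r s (inj₂ (¬p , _)) (inj₁ (p , _))   = contradiction p ¬p
  ShiftVal-functional r s (inj₂ (_ , e))  (inj₂ (_ , e′))  = trans e (≡-sym e′)

  -- If both elements lie above `r`, then `r` lies below both orientations of `z₂` and is light. In
  -- the mixed cases joining with `s` is monotone, and if neither lies above `r`, both elements only
  -- shrink.
  ShiftVal-star : ∀ {r} s {z₁ z₂ w₁ w₂} → ¬ Light r → S z₂ → z₁ ⊑ inv z₂ →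
    ShiftVal G r s z₁ w₁ → ShiftVal G r s z₂ w₂ → w₁ ⊑ inv w₂
  ShiftVal-star {r} s {z₁} {z₂} ¬light z₂∈S le (inj₁ (r⊑z₁ , _)) (inj₁ (r⊑z₂ , _)) =
    contradiction (⊑-both⇒light k r z₂ z₂∈S r⊑z₂ (⊑-trans r z₁ (inv z₂) r⊑z₁ le)) ¬light
  ShiftVal-star s {z₁} {z₂} _ _ le (inj₁ (_ , refl)) (inj₂ (_ , refl)) =
    ⊔-monoˡ {z₁} {inv z₂} s le
  ShiftVal-star s {z₁} {z₂} _ _ le (inj₂ (_ , refl)) (inj₁ (_ , refl)) =
    inv-⊑ (z₂ ⊔ s) (inv z₁ ⊔ s)
      (⊔-monoˡ {z₂} {inv z₁} s (inv-⊑ z₁ (inv z₂) le))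
  ShiftVal-star s {z₁} {z₂} _ _ le (inj₂ (_ , refl)) (inj₂ (_ , refl)) =
    ⊑-trans (inv z₁′) z₁ z₂′ (inv-⊑ (inv z₁) z₁′ (⊑-⊔ˡ (inv z₁) s))
      (⊑-trans z₁ (inv z₂) z₂′ le (⊑-⊔ˡ (inv z₂) s))
    where
    z₁′ = inv z₁ ⊔ s
    z₂′ = inv z₂ ⊔ s

  hat-star : ∀ {τ} → H τ → IsStar G τ
  hat-star (base τ∈F*) = proj₂ (proj₂ (proj₂ (proj₁ unc _ τ∈F*)))
  hat-star (shift {τ} {τ′} r s _ r∈S _ _ ¬forced (_ , _ , emul)
                  ((_ , star) , in≥ , _ , pw)) =
    All.tabulate nondeg , distinct
    where
    nondeg : ∀ {w} → w ∈ˡ τ′ → ¬ Degenerate G w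
    nondeg {w} m with pointwise-∈ʳ pw m
    ... | z , z∈τ , v = let (z≥ , z≢) = All.lookup in≥ z∈τ in
      nondegenerate w (emul z w z≥ z≢ v)
    distinct : ∀ w₁ w₂ → w₁ ∈ˡ τ′ → w₂ ∈ˡ τ′ → w₁ ≢ w₂ → w₁ ⊑ inv w₂
    distinct w₁ w₂ m₁ m₂ w₁≢w₂ with pointwise-∈ʳ pw m₁ | pointwise-∈ʳ pw m₂
    ... | z₁ , i₁ , v₁ | z₂ , i₂ , v₂ =
      ShiftVal-star s (¬forced ∘ light⇒InF r∈S) (proj₁ (proj₁ (All.lookup in≥ i₂)))
        (star z₁ z₂ i₁ i₂ λ { refl → w₁≢w₂ (ShiftVal-functional r s v₁ v₂) }) v₁ v₂

  shiftEl : Sep → Sep → Sep → Sep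
  shiftEl r s z with r ⊑? z
  ... | yes _ = z ⊔ s
  ... | no _  = inv (inv z ⊔ s)

  shiftEl-val : ∀ r s z → ShiftVal G r s z (shiftEl r s z)
  shiftEl-val r s z with r ⊑? z
  ... | yes p = inj₁ (p , refl)
  ... | no ¬p = inj₂ (¬p , refl)

  -- For `z` above `r`, the meet of `z` and `s` lies between `r` and `s`, so its order is at least
  -- that of `s`; by submodularity the join has order at most that of `z`.
  linked⇒emulates : ∀ r s → S s → r ⊑ s →
    (∀ t → S t → r ⊑ t → t ⊑ s → order G s ≤ order G t) → Emulates G k s r
  linked⇒emulates r s s∈S@(s-sep , s<k) r⊑s least = s∈S , r⊑s , λ where
      z _ (z∈S , _) _ (inj₁ (r⊑z , refl)) → join z z∈S r⊑z
      z _ (z∈S , inj₁ r⊑z) _ (inj₂ (r⋢z , _)) → contradiction r⊑z r⋢z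
      z _ (z∈S , inj₂ r⊑z*) _ (inj₂ (_ , refl)) →
        InS-inv k (inv z ⊔ s) (join (inv z) (InS-inv k z z∈S) r⊑z*)
    where
    join : ∀ z → S z → r ⊑ z → S (z ⊔ s)
    join z (z-sep , z<k) r⊑z =
      IsSep-⊔ z s z-sep s-sep ,
      ≰⇒> λ k≤ → <⇒≱ z<k (≤-trans k≤ (+-cancelʳ-≤ (order G s) _ _ (≤-trans
        (+-monoʳ-≤ (order G (z ⊔ s)) s≤meet)
        (∣∩∣-submodular (proj₁ z) (proj₂ z) (proj₁ s) (proj₂ s)))))
      where
      s≤meet : order G s ≤ order G (z ⊓ s)
      s≤meet = ≮⇒≥ λ meet<s → <⇒≱ meet<s (least (z ⊓ s)
        (IsSep-⊓ z s z-sep s-sep , <-trans meet<s s<k)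
        ((λ m → x∈p∩q⁺ (proj₁ r⊑z m , proj₁ r⊑s m)) ,
         (λ m → [ proj₂ r⊑z , proj₂ r⊑s ]′ (x∈p∪q⁻ (proj₂ z) (proj₂ s) m)))
        (p∩q⊆q (proj₁ z) (proj₁ s) , q⊆p∪q (proj₂ z) (proj₂ s)))

  -- Derivations

  -- D P x says that x labels the top edge, directed upwards, of a rooted tree all of whose nodes
  -- carry stars in the hat, except for leaves with a star {y*} for some y in P.  Reading a star
  -- as the clause "not all of its elements", x follows from P by unit propagation.  As the rule
  -- unit only looks at elements of σ other than x*, these trees are irredundant.
  data D (P : Sep → Set) : Sep → Set where
    given : ∀ {x} → S x → P x → D P x
    unit  : ∀ {σ x} → H σ → S x → inv x ∈ˡ σ →
            (∀ y → y ∈ˡ σ → y ≢ inv x → D P y) → D P x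

  D⇒S : ∀ {P x} → D P x → S x
  D⇒S (given x∈S _)    = x∈S
  D⇒S (unit _ x∈S _ _) = x∈S

  -- Two rooted trees whose top edges carry inverse labels are glued along that edge to form an
  -- unrooted tree with leaves from `P`.
  Contradictory : (Sep → Set) → Set
  Contradictory P = ∃[ x ] (D P x × D P (inv x))

  _⊕_ : (Sep → Set) → Sep → Sep → Set
  (P ⊕ r) x = P x ⊎ x ≡ r

  DownClosed : (Sep → Set) → Set
  DownClosed P = ∀ x y → S y → y ⊑ x → P x → P y

  -- The tree for x is re-rooted at one of its leaves labelled r, if there is any.
  reroot : ∀ {P r x} → D (P ⊕ r) x → D (P ⊕ r) (inv x) → D P x ⊎ D (P ⊕ r) (inv r)
  reroot (given x∈S (inj₁ p)) e    = inj₁ (given x∈S p)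
  reroot (given _ (inj₂ refl)) e   = inj₂ e
  reroot {P} {r} {x} (unit {σ} h x∈S x*∈σ kids) e =
    [ inj₁ ∘ unit h x∈S x*∈σ , inj₂ ]′ (all-or σ rerooted)
    where
    rerooted : ∀ y → y ∈ˡ σ → (y ≢ inv x → D P y) ⊎ D (P ⊕ r) (inv r)
    rerooted y y∈σ with y ≟ inv x
    ... | yes y≡x* = inj₁ λ y≢x* → contradiction y≡x* y≢x*
    -- The root moves one node down: with `e` supplying x*, the same star derives y*.
    ... | no y≢x*  = [ (λ d → inj₁ λ _ → d) , inj₂ ]′ (reroot (kids y y∈σ y≢x*)
            (unit h (InS-inv k y (D⇒S (kids y y∈σ y≢x*))) y∈σ other))
      where
      other : ∀ z → z ∈ˡ σ → z ≢ y → D (P ⊕ r) z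
      other z z∈σ _ with z ≟ inv x
      ... | yes refl = e
      ... | no z≢x*  = kids z z∈σ z≢x*

  -- Shifting derivations.

  module _ {P : Sep → Set} (closed : DownClosed P) {r s : Sep} (r∈S : S r)
           (heavy : ¬ Light r) (emul : Emulates G k s r) where

    private
      r⊑s = proj₁ (proj₂ emul)

      no-both : ∀ x → S x → r ⊑ x → ¬ r ⊑ inv x
      no-both x x∈S p q = heavy (⊑-both⇒light k r x x∈S p q)

      r⊔s≡s : r ⊔ s ≡ s
      r⊔s≡s = ⊑-antisym (r ⊔ s) s (⊔-least r s s r⊑s (⊑-refl s)) (⊑-⊔ʳ r s)

      -- The value of the shift at `y` when y* lies above `r`; it lies below `y`, so it stays in the
      -- down-closed `P`.
      below : Sep → Sep
      below y = inv (inv y ⊔ s)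

      shiftEl-below : ∀ y → ¬ r ⊑ y → shiftEl r s y ≡ below y
      shiftEl-below y r⋢y with r ⊑? y
      ... | yes r⊑y = contradiction r⊑y r⋢y
      ... | no _    = refl

      shiftEl-above : ∀ y → r ⊑ y → shiftEl r s y ≡ y ⊔ s
      shiftEl-above y r⊑y with r ⊑? y
      ... | yes _  = refl
      ... | no r⋢y = contradiction r⊑y r⋢y

    -- The second alternative arises when r* occurs below y: the tree is then cut off there.
    shift-below : ∀ {y} → D (P ⊕ r) y → r ⊑ inv y → D P (below y) ⊎ D P (inv s)
    shift-below {y} d r⊑y* = helper d
      where
      y∈S = D⇒S d
      y*∈S = InS-inv k y y∈S
      y*≢r* : inv y ≢ inv r
      y*≢r* eq = no-both r r∈S (⊑-refl r) (subst (r ⊑_) eq r⊑y*)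
      below∈S : S (below y)
      below∈S = InS-inv k (inv y ⊔ s)
        (proj₂ (proj₂ emul) (inv y) _ (y*∈S , inj₁ r⊑y*) y*≢r* (inj₁ (r⊑y* , refl)))
      helper : D (P ⊕ r) y → D P (below y) ⊎ D P (inv s)
      helper (given _ (inj₁ p)) = inj₁ (given below∈S
        (closed y (below y) below∈S
          (inv-⊑ (inv y) (inv y ⊔ s) (⊑-⊔ˡ (inv y) s)) p))
      helper (given _ (inj₂ refl)) = ⊥-elim (no-both r r∈S (⊑-refl r) r⊑y*)
      helper (unit {σ} h _ y*∈σ kids) with inv r ∈ˡ? σ
      -- The shift is undefined at r*, so this node is dropped: the branch at r* already derives (r
      -- ∨ s)*, which is s*.
      ... | yes r*∈σ = inj₂ ([ subst (λ t → D P (inv t)) r⊔s≡s , id ]′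
              (shift-below (kids (inv r) r*∈σ (y*≢r* ∘ ≡-sym)) (⊑-refl r)))
      ... | no r*∉σ = [ inj₁ ∘ unit shifted-star below∈S y*⊔s∈ ∘ others , inj₂ ]′ (all-or σ shifted)
        where
        above : ∀ z → z ∈ˡ σ → z ≢ inv y → r ⊑ inv z
        above z z∈σ z≢y* = ⊑-trans r (inv y) (inv z) r⊑y*
          (proj₂ (hat-star h) (inv y) z y*∈σ z∈σ (z≢y* ∘ ≡-sym))
        shifted : ∀ z → z ∈ˡ σ → (z ≢ inv y → D P (below z)) ⊎ D P (inv s)
        shifted z z∈σ with z ≟ inv y
        ... | yes z≡y* = inj₁ λ z≢y* → contradiction z≡y* z≢y*
        ... | no z≢y*  = [ (λ e → inj₁ λ _ → e) , inj₂ ]′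
                (shift-below (kids z z∈σ z≢y*) (above z z∈σ z≢y*))
        in≥ : ∀ z → z ∈ˡ σ → InS≥ G k r z × z ≢ inv r
        in≥ z z∈σ with z ≟ inv y
        ... | yes refl = (y*∈S , inj₁ r⊑y*) , y*≢r*
        ... | no z≢y*  = (D⇒S (kids z z∈σ z≢y*) , inj₂ (above z z∈σ z≢y*)) ,
                         λ { refl → r*∉σ z∈σ }
        shifted-star : H (map (shiftEl r s) σ)
        shifted-star = shift r s h r∈S
          -- Since `r` is not light, it is neither trivial nor forced.
          (λ (t , t∈S , (r⊑t , _) , (r⊑t* , _)) → no-both t t∈S r⊑t r⊑t*)
          (nondegenerate r r∈S)
          (λ (_ , r<k) → heavy
            (≤-<-trans (card-mono (proj₁ r) (proj₁ r ∩ ⊤) λ m → x∈p∩q⁺ (m , ∈⊤)) r<k))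
          emul
          (hat-star h , All.tabulate (λ {z} → in≥ z) , (inv y , y*∈σ , r⊑y*) ,
           pointwise-map (shiftEl-val r s) σ)
        y*⊔s∈ : inv (below y) ∈ˡ map (shiftEl r s) σ
        y*⊔s∈ = subst (_∈ˡ map (shiftEl r s) σ) (shiftEl-above (inv y) r⊑y*)
                  (∈-map⁺ (shiftEl r s) y*∈σ)
        others : (∀ z → z ∈ˡ σ → z ≢ inv y → D P (below z)) →
                 ∀ w → w ∈ˡ map (shiftEl r s) σ → w ≢ inv (below y) → D P w
        others ds w m w≢ with ∈-map⁻ (shiftEl r s) m
        ... | z , z∈σ , refl with z ≟ inv y
        ...   | yes refl = contradiction (shiftEl-above (inv y) r⊑y*) w≢
        ...   | no z≢y*  = subst (D P)
                (≡-sym (shiftEl-below z λ r⊑z →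
                  no-both z (D⇒S (kids z z∈σ z≢y*)) r⊑z (above z z∈σ z≢y*)))
                (ds z z∈σ z≢y*)

    -- Both alternatives of `shift-below` at r* give s*, the first because (r ∨ s)* is s*.
    shift-derivation : D (P ⊕ r) (inv r) → D P (inv s)
    shift-derivation d =
      [ subst (λ t → D P (inv t)) r⊔s≡s , id ]′ (shift-below d (⊑-refl r))

  -- Enlarging the set of leaves.

  uncross-preserves : ∀ {Q : Sep → Set} →
    (∀ a b → Q a → S (a ⊓ b) → Q (a ⊓ b)) →
    ∀ {σ τ} → Star (UncrossStep G k) σ τ → (∀ z → z ∈ˡ σ → Q z) → ∀ z → z ∈ˡ τ → Q z
  uncross-preserves meet ε qs = qs
  uncross-preserves {Q} meet ((a , b , a∈σ , _ , _ , a∧b*∈S , σ′≋) ◅ steps) qs =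
    uncross-preserves meet steps λ z m → [ (λ (z∈σ , _) → qs z z∈σ) ,
      (λ eq → subst Q (≡-sym eq) (meet a (inv b) (qs a a∈σ) a∧b*∈S)) ]′ (to (σ′≋ z) m)

  uncross-nonempty : ∀ {σ τ} → Star (UncrossStep G k) σ τ → ∃ (_∈ˡ σ) → ∃ (_∈ˡ τ)
  uncross-nonempty ε i = i
  uncross-nonempty ((_ , _ , _ , _ , _ , _ , σ′≋) ◅ steps) _ =
    uncross-nonempty steps (_ , from (σ′≋ _) (inj₂ refl))

  total⇒block⊎contradictory : ∀ {P} → Decidable P → DownClosed P →
    (∀ x → S x → P x ⊎ P (inv x)) → HasBlock G k ⊎ Contradictory P
  total⇒block⊎contradictory {P} P? closed total = split (k ≤? ∣ ⋂B G O ∣)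
    where
    O : List Sep
    O = filter (λ x → InS? k x ×-dec P? x) seps
    ∈O⁺ : ∀ x → S x → P x → x ∈ˡ O
    ∈O⁺ x x∈S p = ∈-filter⁺ (λ x → InS? k x ×-dec P? x) (∈-seps x) (x∈S , p)
    ∈O⁻ : ∀ x → x ∈ˡ O → S x × P x
    ∈O⁻ x m = proj₂ (∈-filter⁻ (λ x → InS? k x ×-dec P? x) {xs = seps} m)
    O⊆S : All S O
    O⊆S = All.tabulate λ {x} m → proj₁ (∈O⁻ x m)
    -- The empty intersection is V, which has at least k vertices.
    O-nonempty : ∀ σ → ∣ ⋂B G σ ∣ < k → ∃ (_∈ˡ σ)
    O-nonempty []      ⊤<k = contradiction k≤n (<⇒≱ ⊤<k)
    O-nonempty (x ∷ _) _   = x , here refl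
    split : Dec (k ≤ ∣ ⋂B G O ∣) → HasBlock G k ⊎ Contradictory P
    split (yes k≤) = inj₁ (orientation⇒block O O⊆S
      (λ x x∈S → [ inj₁ ∘ ∈O⁺ x x∈S , inj₂ ∘ ∈O⁺ (inv x) (InS-inv k x x∈S) ]′ (total x x∈S)) k≤)
    split (no k≰) with proj₂ unc O (O⊆S , ≰⇒> k≰)
    ... | τ , τ∈F* , steps , _ with uncross-nonempty steps (O-nonempty O (≰⇒> k≰))
    -- All of `τ` lies in `P`, since uncrossing only replaces elements by smaller ones. So `y` is a
    -- leaf, and the star `τ` derives y* from its elements.
    ...   | y , y∈τ = inj₂ (y , derive y y∈τ , unit (base τ∈F*)
              (InS-inv k y (proj₁ (τ⊆P y y∈τ))) y∈τ (λ z m _ → derive z m))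
      where
      τ⊆P : ∀ z → z ∈ˡ τ → S z × P z
      τ⊆P = uncross-preserves {λ z → S z × P z}
        (λ a b (_ , p) m∈S → m∈S , closed a _ m∈S
          (p∩q⊆p (proj₁ a) (proj₁ b) , p⊆p∪q (proj₂ b)) p) steps ∈O⁻
      derive : ∀ z → z ∈ˡ τ → D P z
      derive z m = given (proj₁ (τ⊆P z m)) (proj₂ (τ⊆P z m))

  -- Minimality is what keeps `P ⊕ r′` down-closed.
  minimal-outside : ∀ {P} → Decidable P → ∀ r → S r → ¬ P r →
    ∃[ r′ ] (S r′ × ¬ P r′ × r′ ⊑ r × (∀ y → S y → y ⊑ r′ → P y ⊎ y ≡ r′))
  minimal-outside {P} P? r r∈S ¬p
    with minimal (λ x → InS? k x ×-dec ¬? (P? x) ×-dec x ⊑? r) rank r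
           (r∈S , ¬p , ⊑-refl r)
  ... | r′ , (r′∈S , ¬p′ , r′⊑r) , least = r′ , r′∈S , ¬p′ , r′⊑r , below
    where
    below : ∀ y → S y → y ⊑ r′ → P y ⊎ y ≡ r′
    below y y∈S y⊑r′ with P? y
    ... | yes p = inj₁ p
    ... | no ¬p = inj₂ (rank-strict y r′ y⊑r′
            (least y (y∈S , ¬p , ⊑-trans y r′ r y⊑r′ r′⊑r)))

  -- The order is invariant under inversion, so one `s` of minimum order between r₁ and r₂*
  -- satisfies `linked⇒emulates` from both ends.
  linking : ∀ r₁ r₂ → S r₁ → r₁ ⊑ inv r₂ →
            ∃[ s ] (Emulates G k s r₁ × Emulates G k (inv s) r₂)
  linking r₁ r₂ r₁∈S r₁⊑r₂*
    with minimal (λ x → InS? k x ×-dec r₁ ⊑? x ×-dec x ⊑? inv r₂) (order G) r₁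
           (r₁∈S , ⊑-refl r₁ , r₁⊑r₂*)
  ... | s , (s∈S , r₁⊑s , s⊑r₂*) , least =
    s ,
    linked⇒emulates r₁ s s∈S r₁⊑s (λ t t∈S r₁⊑t t⊑s →
      least t (t∈S , r₁⊑t , ⊑-trans t s (inv r₂) t⊑s s⊑r₂*)) ,
    linked⇒emulates r₂ (inv s) (InS-inv k s s∈S) (inv-⊑ s (inv r₂) s⊑r₂*)
      (λ t t∈S r₂⊑t t⊑s* → subst₂ _≤_ (≡-sym (order-inv s)) (order-inv t)
        (least (inv t) (InS-inv k t t∈S ,
          ⊑-trans r₁ s (inv t) r₁⊑s (inv-⊑ t (inv s) t⊑s*) , inv-⊑ r₂ t r₂⊑t)))

  ⊕-downClosed : ∀ {P r} → DownClosed P → (∀ y → S y → y ⊑ r → P y ⊎ y ≡ r) →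
                 DownClosed (P ⊕ r)
  ⊕-downClosed closed below x y y∈S y⊑x (inj₁ p)    = inj₁ (closed x y y∈S y⊑x p)
  ⊕-downClosed closed below x y y∈S y⊑x (inj₂ refl) = below y y∈S y⊑x

  -- Either neither tree has a leaf labelled `r`, or one of them is re-rooted at such a leaf, the
  -- other tree being attached at its old root.
  contradictory-⊕ : ∀ {P r} → Contradictory (P ⊕ r) → Contradictory P ⊎ D (P ⊕ r) (inv r)
  contradictory-⊕ (x , d , e) with reroot d e | reroot e d
  ... | inj₂ f  | _       = inj₂ f
  ... | inj₁ _  | inj₂ f  = inj₂ f
  ... | inj₁ d′ | inj₁ e′ = inj₁ (x , d′ , e′)

  remove : Sep → List Sep → List Sep
  remove r = filter (λ x → ¬? (x ≟ r))

  -- W lists the separations that P may still lack; its length bounds the recursion depth.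
  block⊎contradictory : ∀ ℓ {P} → Decidable P → DownClosed P → (∀ x → Light x → P x) →
    ∀ W → (∀ x → S x → ¬ P x → x ∈ˡ W) → length W < ℓ → HasBlock G k ⊎ Contradictory P
  block⊎contradictory (suc ℓ) {P} P? closed light W rest W<
    with anySep? (λ x → InS? k x ×-dec ¬? (P? x) ×-dec ¬? (P? (inv x)))
  ... | no oriented = total⇒block⊎contradictory P? closed total
    where
    total : ∀ x → S x → P x ⊎ P (inv x)
    total x x∈S with P? x | P? (inv x)
    ... | yes p | _     = inj₁ p
    ... | no _  | yes p = inj₂ p
    ... | no ¬p | no ¬q = contradiction (x , x∈S , ¬p , ¬q) oriented
  ... | yes (r , r∈S , ¬pr , ¬pr*)
    with minimal-outside P? r r∈S ¬pr | minimal-outside P? (inv r) (InS-inv k r r∈S) ¬pr*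
  ... | r₁ , r₁∈S , ¬p₁ , r₁⊑r , below₁ | r₂ , r₂∈S , ¬p₂ , r₂⊑r* , below₂
    with extend r₁ r₁∈S ¬p₁ below₁ | extend r₂ r₂∈S ¬p₂ below₂
    where
    extend : ∀ r → S r → ¬ P r → (∀ y → S y → y ⊑ r → P y ⊎ y ≡ r) →
             HasBlock G k ⊎ (Contradictory P ⊎ D (P ⊕ r) (inv r))
    extend r r∈S ¬p below = [ inj₁ , inj₂ ∘ contradictory-⊕ ]′
      (block⊎contradictory ℓ (λ x → P? x ⊎-dec x ≟ r) (⊕-downClosed closed below)
        (λ x → inj₁ ∘ light x) (remove r W)
        (λ x x∈S ¬p⊕ → ∈-filter⁺ (λ x → ¬? (x ≟ r)) (rest x x∈S (¬p⊕ ∘ inj₁)) (¬p⊕ ∘ inj₂))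
        (<-≤-trans (List.filter-notAll (λ x → ¬? (x ≟ r)) W
          (lose (rest r r∈S ¬p) λ r≢r → r≢r refl)) (≤-pred W<)))
  ... | inj₁ block     | _              = inj₁ block
  ... | inj₂ _         | inj₁ block     = inj₁ block
  ... | inj₂ (inj₁ c)  | inj₂ _         = inj₂ c
  ... | inj₂ (inj₂ _)  | inj₂ (inj₁ c)  = inj₂ c
  ... | inj₂ (inj₂ d₁) | inj₂ (inj₂ d₂)
    with linking r₁ r₂ r₁∈S (⊑-trans r₁ r (inv r₂) r₁⊑r (inv-⊑ r₂ (inv r) r₂⊑r*))
  -- Shifting `d₂` from r₂ to s* derives `s`, and shifting `d₁` from r₁ to `s` derives s*.
  ...   | s , emul₁ , emul₂ = inj₂ (s ,
    shift-derivation closed r₂∈S (¬p₂ ∘ light r₂) emul₂ d₂ ,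
    shift-derivation closed r₁∈S (¬p₁ ∘ light r₁) emul₁ d₁)

  block⊎light-contradictory : HasBlock G k ⊎ Contradictory Light
  block⊎light-contradictory = block⊎contradictory (suc (length seps)) (λ x → _ <? k)
    (λ x y _ y⊑x → ≤-<-trans (p⊆q⇒∣p∣≤∣q∣ (proj₁ y⊑x))) (λ _ → id)
    seps (λ x _ _ → ∈-seps x) (n<1+n _)

  -- From derivations to trees

  -- The set required at a node of `STree`, with `lab` as the upward labels and their inverses as
  -- the downward ones.
  Incoming : ∀ {m} → (Fin m → Fin (suc m)) → (Fin m → Sep) → Fin (suc m) → Sep → Set
  Incoming parent lab t z = ∃[ i ] ((parent i ≡ t × z ≡ lab i) ⊎ (suc i ≡ t × z ≡ inv (lab i)))

  -- A rooted tree, coded as in STree, whose nodes other than the root satisfy the star condition;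
  -- the edges at the root carry the separations ys.
  record Forest (ys : List Sep) : Set where
    field
      m       : ℕ
      parent  : Fin m → Fin (suc m)
      parent< : ∀ i → toℕ (parent i) ≤ toℕ i
      lab     : Fin m → Sep
      lab-S   : ∀ i → S (lab i)
      root    : ∀ z → (z ∈ˡ ys) ⇔ Incoming parent lab zero z
      nodes   : ∀ j → InClosure G k F* (Incoming parent lab (suc j))

  empty : Forest []
  empty = record
    { m = 0 ; parent = λ () ; parent< = λ () ; lab = λ () ; lab-S = λ ()
    ; root = λ z → mk⇔ (λ ()) (λ { (() , _) }) ; nodes = λ () }

  InClosure-resp : ∀ {P Q : Sep → Set} → (∀ z → P z ⇔ Q z) →
                   InClosure G k F* P → InClosure G k F* Q
  InClosure-resp P⇔Q (τ , c , τ⇔P) = τ , c , λ z →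
    mk⇔ (to (P⇔Q z) ∘ to (τ⇔P z)) (from (τ⇔P z) ∘ from (P⇔Q z))

  -- A new root is put on top, joined to the old root by an edge labelled `x`. The old root becomes
  -- node 1 and receives the star `σ`.
  plant : ∀ {x ys σ} → S x → Forest ys → H σ → (∀ z → (z ∈ˡ σ) ⇔ (z ≡ inv x ⊎ z ∈ˡ ys)) →
          Forest (x ∷ [])
  plant {x} {ys} {σ} x∈S f h σ⇔ = record
    { m = suc m
    ; parent = parent′
    ; parent< = λ { zero → z≤n ; (suc i) → s≤s (parent< i) }
    ; lab = lab′
    ; lab-S = λ { zero → x∈S ; (suc i) → lab-S i }
    ; root = λ z → mk⇔
        (λ { (here refl) → zero , inj₁ (refl , refl) })
        (λ { (zero , inj₁ (_ , refl)) → here refl })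
    ; nodes = nodes′
    }
    where
    open Forest f
    parent′ : Fin (suc m) → Fin (suc (suc m))
    parent′ zero    = zero
    parent′ (suc i) = suc (parent i)
    lab′ : Fin (suc m) → Sep
    lab′ zero    = x
    lab′ (suc i) = lab i
    lift : ∀ {t z} → Incoming parent lab t z → Incoming parent′ lab′ (suc t) z
    lift (i , inj₁ (refl , e)) = suc i , inj₁ (refl , e)
    lift (i , inj₂ (refl , e)) = suc i , inj₂ (refl , e)
    lower : ∀ {t z} → Incoming parent′ lab′ (suc t) z →
            Incoming parent lab t z ⊎ (t ≡ zero × z ≡ inv x)
    lower (suc i , inj₁ (refl , e)) = inj₁ (i , inj₁ (refl , e))
    lower (zero  , inj₂ (refl , e)) = inj₂ (refl , e)
    lower (suc i , inj₂ (refl , e)) = inj₁ (i , inj₂ (refl , e))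
    nodes′ : ∀ j → InClosure G k F* (Incoming parent′ lab′ (suc j))
    nodes′ zero = σ , inj₁ h , λ z → mk⇔
      (λ m → [ (λ e → zero , inj₂ (refl , e)) , lift ∘ to (root z) ]′ (to (σ⇔ z) m))
      (λ inc → from (σ⇔ z) ([ inj₂ ∘ from (root z) , inj₁ ∘ proj₂ ]′ (lower inc)))
    nodes′ (suc j) = InClosure-resp
      (λ z → mk⇔ lift (λ inc → [ id , (λ { (() , _) }) ]′ (lower inc))) (nodes j)

  -- The roots are identified, and the other nodes of the second forest are numbered after those of
  -- the first, so parents still precede children.
  merge : ∀ {ys zs} → Forest ys → Forest zs → Forest (ys ++ zs)
  merge {ys} {zs} f g = record
    { m = m₁ + m₂
    ; parent = parent′
    ; parent< = parent<′
    ; lab = lab′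
    ; lab-S = lab-S′
    ; root = λ z → mk⇔
        ([ left {zero} ∘ to (F.root z) , right {zero} ∘ to (E.root z) ]′ ∘ ∈-++⁻ ys)
        (λ inc → [ (λ { (zero , refl , p) → ∈-++⁺ˡ (from (F.root z) p) }) ,
                   (λ { (zero , refl , p) → ∈-++⁺ʳ ys (from (E.root z) p) }) ]′ (cases inc))
    ; nodes = nodes′
    }
    where
    module F = Forest f
    module E = Forest g
    m₁ = F.m
    m₂ = E.m
    embˡ : Fin (suc m₁) → Fin (suc (m₁ + m₂))
    embˡ t = t ↑ˡ m₂
    embʳ : Fin (suc m₂) → Fin (suc (m₁ + m₂))
    embʳ zero    = zero
    embʳ (suc j) = suc (m₁ ↑ʳ j)

    data Split : Fin (m₁ + m₂) → Set where
      inˡ : ∀ i → Split (i ↑ˡ m₂)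
      inʳ : ∀ j → Split (m₁ ↑ʳ j)
    view : ∀ i → Split i
    view i with splitAt m₁ i in eq
    ... | inj₁ j = subst Split (Fin.splitAt⁻¹-↑ˡ eq) (inˡ j)
    ... | inj₂ j = subst Split (Fin.splitAt⁻¹-↑ʳ eq) (inʳ j)

    parent′ : Fin (m₁ + m₂) → Fin (suc (m₁ + m₂))
    parent′ i = [ embˡ ∘ F.parent , embʳ ∘ E.parent ]′ (splitAt m₁ i)
    lab′ : Fin (m₁ + m₂) → Sep
    lab′ i = [ F.lab , E.lab ]′ (splitAt m₁ i)
    parentˡ : ∀ i → parent′ (i ↑ˡ m₂) ≡ embˡ (F.parent i)
    parentˡ i = cong [ embˡ ∘ F.parent , embʳ ∘ E.parent ]′ (Fin.splitAt-↑ˡ m₁ i m₂)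
    parentʳ : ∀ j → parent′ (m₁ ↑ʳ j) ≡ embʳ (E.parent j)
    parentʳ j = cong [ embˡ ∘ F.parent , embʳ ∘ E.parent ]′ (Fin.splitAt-↑ʳ m₁ m₂ j)
    labˡ : ∀ i → lab′ (i ↑ˡ m₂) ≡ F.lab i
    labˡ i = cong [ F.lab , E.lab ]′ (Fin.splitAt-↑ˡ m₁ i m₂)
    labʳ : ∀ j → lab′ (m₁ ↑ʳ j) ≡ E.lab j
    labʳ j = cong [ F.lab , E.lab ]′ (Fin.splitAt-↑ʳ m₁ m₂ j)

    embʳ-≤ : ∀ t b → toℕ t ≤ b → toℕ (embʳ t) ≤ m₁ + b
    embʳ-≤ zero    b _ = z≤n
    embʳ-≤ (suc j) b le = subst (_≤ m₁ + b)
      (trans (+-suc m₁ (toℕ j)) (cong suc (≡-sym (Fin.toℕ-↑ʳ m₁ j)))) (+-monoʳ-≤ m₁ le)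
    parent<′ : ∀ i → toℕ (parent′ i) ≤ toℕ i
    parent<′ i with view i
    ... | inˡ j = subst₂ _≤_
            (trans (≡-sym (Fin.toℕ-↑ˡ (F.parent j) m₂)) (cong toℕ (≡-sym (parentˡ j))))
            (≡-sym (Fin.toℕ-↑ˡ j m₂)) (F.parent< j)
    ... | inʳ j = subst₂ _≤_ (cong toℕ (≡-sym (parentʳ j))) (≡-sym (Fin.toℕ-↑ʳ m₁ j))
            (embʳ-≤ (E.parent j) (toℕ j) (E.parent< j))
    lab-S′ : ∀ i → S (lab′ i)
    lab-S′ i with view i
    ... | inˡ j = subst S (≡-sym (labˡ j)) (F.lab-S j)
    ... | inʳ j = subst S (≡-sym (labʳ j)) (E.lab-S j)

    left : ∀ {t z} → Incoming F.parent F.lab t z → Incoming parent′ lab′ (embˡ t) z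
    left (i , inj₁ (refl , e)) = i ↑ˡ m₂ , inj₁ (parentˡ i , trans e (≡-sym (labˡ i)))
    left (i , inj₂ (refl , e)) = i ↑ˡ m₂ , inj₂ (refl , trans e (cong (inv) (≡-sym (labˡ i))))
    right : ∀ {t z} → Incoming E.parent E.lab t z → Incoming parent′ lab′ (embʳ t) z
    right (i , inj₁ (refl , e)) = m₁ ↑ʳ i , inj₁ (parentʳ i , trans e (≡-sym (labʳ i)))
    right (i , inj₂ (refl , e)) = m₁ ↑ʳ i , inj₂ (refl , trans e (cong (inv) (≡-sym (labʳ i))))

    cases : ∀ {t z} → Incoming parent′ lab′ t z →
            (∃[ t′ ] (embˡ t′ ≡ t × Incoming F.parent F.lab t′ z)) ⊎
            (∃[ t′ ] (embʳ t′ ≡ t × Incoming E.parent E.lab t′ z))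
    cases (i , p) with view i
    cases (_ , inj₁ (q , e)) | inˡ j =
      inj₁ (F.parent j , trans (≡-sym (parentˡ j)) q , j , inj₁ (refl , trans e (labˡ j)))
    cases (_ , inj₂ (q , e)) | inˡ j =
      inj₁ (suc j , q , j , inj₂ (refl , trans e (cong (inv) (labˡ j))))
    cases (_ , inj₁ (q , e)) | inʳ j =
      inj₂ (E.parent j , trans (≡-sym (parentʳ j)) q , j , inj₁ (refl , trans e (labʳ j)))
    cases (_ , inj₂ (q , e)) | inʳ j =
      inj₂ (suc j , q , j , inj₂ (refl , trans e (cong (inv) (labʳ j))))

    ↑ˡ≢↑ʳ : ∀ (i : Fin m₁) (j : Fin m₂) → i ↑ˡ m₂ ≢ m₁ ↑ʳ j
    ↑ˡ≢↑ʳ i j eq with trans (≡-sym (Fin.splitAt-↑ˡ m₁ i m₂))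
                       (trans (cong (splitAt m₁) eq) (Fin.splitAt-↑ʳ m₁ m₂ j))
    ... | ()

    -- The two embeddings share only the root, so no edge of the second forest meets a non-root node
    -- of the first.
    onlyˡ : ∀ {j z} → Incoming parent′ lab′ (suc (j ↑ˡ m₂)) z → Incoming F.parent F.lab (suc j) z
    onlyˡ {j} {z} inc with cases inc
    ... | inj₁ (t , eq , p) = subst (λ t → Incoming F.parent F.lab t z)
            (Fin.↑ˡ-injective m₂ t (suc j) eq) p
    ... | inj₂ (suc t , eq , _) = contradiction (≡-sym (Fin.suc-injective eq)) (↑ˡ≢↑ʳ j t)

    onlyʳ : ∀ {j z} → Incoming parent′ lab′ (suc (m₁ ↑ʳ j)) z → Incoming E.parent E.lab (suc j) z
    onlyʳ {j} {z} inc with cases inc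
    ... | inj₁ (suc t , eq , _) = contradiction (Fin.suc-injective eq) (↑ˡ≢↑ʳ t j)
    ... | inj₂ (suc t , eq , p) = subst (λ t → Incoming E.parent E.lab (suc t) z)
            (Fin.↑ʳ-injective m₁ t j (Fin.suc-injective eq)) p

    nodes′ : ∀ j → InClosure G k F* (Incoming parent′ lab′ (suc j))
    nodes′ j with view j
    ... | inˡ i = InClosure-resp (λ z → mk⇔ left onlyˡ) (F.nodes i)
    ... | inʳ i = InClosure-resp (λ z → mk⇔ right onlyʳ) (E.nodes i)

  forest : ∀ ys → (∀ y → y ∈ˡ ys → Forest (y ∷ [])) → Forest ys
  forest []       fs = empty
  forest (y ∷ ys) fs = merge (fs y (here refl)) (forest ys λ z → fs z ∘ there)

  -- The singleton {x*} belongs to 𝓑_k and uncrosses only to itself, so every leaf from `Light`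
  -- carries a star of the hat.
  light-star : ∀ {x} → S x → Light x → H (inv x ∷ [])
  light-star x∈S x-light = base (proj₁ (InF-singleton (light⇒InF x∈S x-light)))

  derivation⇒forest : ∀ {x} → D Light x → Forest (x ∷ [])
  derivation⇒forest (given x∈S x-light) = plant x∈S empty (light-star x∈S x-light)
    λ z → mk⇔ (λ { (here e) → inj₁ e }) (λ { (inj₁ e) → here e })
  derivation⇒forest {x} (unit {σ} h x∈S x*∈σ kids) =
    -- Repeated entries of `σ` yield parallel subtrees, which leave the set of labels at the node
    -- unchanged.
    plant x∈S (forest (remove (inv x) σ) sub) h λ z → mk⇔ (split z)
      [ (λ { refl → x*∈σ }) , proj₁ ∘ ∈-filter⁻ ≢x*? ]′
    where
    ≢x*? = λ y → ¬? (y ≟ inv x)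
    sub : ∀ y → y ∈ˡ remove (inv x) σ → Forest (y ∷ [])
    sub y m = let (y∈σ , y≢x*) = ∈-filter⁻ ≢x*? {xs = σ} m in derivation⇒forest (kids y y∈σ y≢x*)
    split : ∀ z → z ∈ˡ σ → z ≡ inv x ⊎ z ∈ˡ remove (inv x) σ
    split z z∈σ with z ≟ inv x
    ... | yes e = inj₁ e
    ... | no ≢  = inj₂ (∈-filter⁺ ≢x*? z∈σ ≢)

  forest⇒tree : ∀ {σ} → H σ → Forest σ → STree G k F*
  forest⇒tree {σ} h f = record
    { m = m ; parent = parent ; parent< = parent< ; α = α′ ; α-inv = λ _ → refl ; α-S = α-S′
    ; nodes-ok = λ { zero → σ , inj₁ h , root ; (suc j) → nodes j } }
    where
    open Forest f
    α′ : Fin m → Dir G → Sep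
    α′ i up   = lab i
    α′ i down = inv (lab i)
    α-S′ : ∀ i d → S (α′ i d)
    α-S′ i up   = lab-S i
    α-S′ i down = InS-inv k (lab i) (lab-S i)

  -- The top node of the tree for `x` becomes the root, and the tree for x* hangs below it in place
  -- of the top edge.
  contradictory⇒tree : Contradictory Light → STree G k F*
  contradictory⇒tree (x , given x∈S x-light , e) = forest⇒tree (light-star x∈S x-light)
    (derivation⇒forest e)
  contradictory⇒tree (x , unit {σ} h _ _ kids , e) = forest⇒tree h (forest σ sub)
    where
    sub : ∀ y → y ∈ˡ σ → Forest (y ∷ [])
    sub y y∈σ with y ≟ inv x
    ... | yes refl = derivation⇒forest e
    ... | no y≢x*  = derivation⇒forest (kids y y∈σ y≢x*)

  -- Blocks exclude trees

  module _ {I : Subset n} (k≤I : k ≤ ∣ I ∣) (insep : Inseparable G k I) where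

    private
      Towards : Sep → Set
      Towards s = I ⊆ proj₂ s

    side : ∀ s → S s → Towards s ⊎ Towards (inv s)
    side s s∈S with Fin.any? (λ v → (v ∈? I) ×-dec ¬? (v ∈? proj₂ s))
    ... | yes (v , v∈I , v∉B) = inj₂ (inseparable-side insep s s∈S v∈I v∉B)
    ... | no all = inj₁ λ {x} x∈I →
      decidable-stable (x ∈? proj₂ s) λ x∉B → all (x , x∈I , x∉B)

    not-both : ∀ s → S s → Towards s → ¬ Towards (inv s)
    not-both s s∈S p q = large⊈separator s I s∈S k≤I q p

    -- If `a` pointed away from the block while `b` points towards it, `I` would lie in the first
    -- side of a ∧ b*, which also points towards `I`; but no separation in S_k has `I` on both
    -- sides.
    uncross-reflects-towards : ∀ {σ τ} → Star (UncrossStep G k) σ τ → All S σ →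
      (∀ z → z ∈ˡ τ → Towards z) → ∀ z → z ∈ˡ σ → Towards z
    uncross-reflects-towards ε _ ts = ts
    uncross-reflects-towards {σ} ((a , b , a∈σ , b∈σ , a≢b , a∧b*∈S , σ′≋) ◅ steps) σ⊆S ts = reflect
      where
      ts′ : ∀ z → z ∈ˡ _ → Towards z
      ts′ = uncross-reflects-towards steps (All.tabulate λ {z} m →
        [ (λ (z∈σ , _) → All.lookup σ⊆S z∈σ) , (λ { refl → a∧b*∈S }) ]′ (to (σ′≋ z) m)) ts
      b-towards : Towards b
      b-towards = ts′ b (from (σ′≋ b) (inj₁ (b∈σ , a≢b ∘ ≡-sym)))
      reflect : ∀ z → z ∈ˡ σ → Towards z
      reflect z z∈σ with z ≟ a
      ... | no z≢a = ts′ z (from (σ′≋ z) (inj₁ (z∈σ , z≢a)))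
      ... | yes refl with side a (All.lookup σ⊆S a∈σ)
      ...   | inj₁ t = t
      ...   | inj₂ t = ⊥-elim (not-both _ a∧b*∈S (ts′ _ (from (σ′≋ _) (inj₂ refl)))
                λ i → x∈p∩q⁺ (t i , b-towards i))

    -- For a member of F*, `I` would lie in the intersection of the second sides of the family it
    -- came from, which is too small. For a shift, the element above `r` shows that `s` points
    -- towards `I`; an unshifted element pointing away would then make its image have `I` on both
    -- sides.
    hat-avoids : ∀ {τ} → H τ → ¬ (∀ z → z ∈ˡ τ → Towards z)
    hat-avoids (base {τ} τ∈F*) ts with proj₁ unc τ τ∈F*
    ... | σ , (σ⊆S , ⋂<k) , steps , _ = <⇒≱ ⋂<k (≤-trans k≤I (p⊆q⇒∣p∣≤∣q∣ λ i →
      ∈-⋂B σ λ z z∈σ → uncross-reflects-towards steps σ⊆S ts z z∈σ i))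
    hat-avoids (shift {τ} {τ′} r s h _ _ _ _ (_ , _ , emul) (_ , in≥ , (x , x∈τ , r⊑x) , pw)) ts =
      hat-avoids h reflect
      where
      s-towards : Towards s
      s-towards with pointwise-∈ˡ pw x∈τ
      ... | w , w∈τ′ , inj₁ (_ , refl) = λ i → p∩q⊆q (proj₂ x) (proj₂ s) (ts w w∈τ′ i)
      ... | _ , _ , inj₂ (r⋢x , _)     = contradiction r⊑x r⋢x
      reflect : ∀ z → z ∈ˡ τ → Towards z
      reflect z z∈τ with pointwise-∈ˡ pw z∈τ
      ... | w , w∈τ′ , inj₁ (_ , refl) = λ i → p∩q⊆p (proj₂ z) (proj₂ s) (ts w w∈τ′ i)
      ... | w , w∈τ′ , v@(inj₂ (_ , refl)) with All.lookup in≥ z∈τ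
      ...   | z≥@(z∈S , _) , z≢r* with side z z∈S
      ...     | inj₁ t = t
      ...     | inj₂ t = ⊥-elim (not-both w (emul z w z≥ z≢r* v) (ts w w∈τ′)
                  λ i → x∈p∩q⁺ (t i , s-towards i))

    closure-avoids : ∀ {τ} → Closure G k F* τ → ¬ (∀ z → z ∈ˡ τ → Towards z)
    closure-avoids (inj₁ h) ts = hat-avoids h ts
    -- As x* is small, the second side of `x` lies in the first, and `I` would lie in both.
    closure-avoids (inj₂ (x , x∈S , (B⊆A , _) , refl)) ts =
      not-both x x∈S (ts x (here refl)) (λ i → B⊆A (ts x (here refl) i))

    block⇒¬tree : ¬ STree G k F*
    block⇒¬tree T = sink (last (λ i → I ⊆? proj₂ (α i down)))
      where
      open STree T
      up-towards : ∀ i → ¬ Towards (α i down) → Towards (α i up)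
      up-towards i ¬t with side (α i up) (α-S i up)
      ... | inj₁ t = t
      ... | inj₂ t = ⊥-elim (¬t (subst Towards (≡-sym (α-inv i)) t))
      no-sink : ∀ t → ¬ (∀ i → (parent i ≡ t → Towards (α i up)) × (suc i ≡ t → Towards (α i down)))
      no-sink t h with nodes-ok t
      ... | τ , c , τ⇔ = closure-avoids c λ z z∈τ → incoming (to (τ⇔ z) z∈τ)
        where
        incoming : ∀ {z} → ∃[ i ] ((parent i ≡ t × z ≡ α i up) ⊎ (suc i ≡ t × z ≡ α i down)) →
                   Towards z
        incoming (i , inj₁ (e , refl)) = proj₁ (h i) e
        incoming (i , inj₂ (e , refl)) = proj₂ (h i) e
      -- The last edge directed away from the root ends in a sink, since the edges to the children
      -- of its end have larger indices.
      sink : (∀ i → ¬ Towards (α i down)) ⊎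
             (∃[ i ] (Towards (α i down) × (∀ j → toℕ i < toℕ j → ¬ Towards (α j down)))) → ⊥
      sink (inj₁ none) = no-sink zero λ i → (λ _ → up-towards i (none i)) , λ ()
      sink (inj₂ (i , away , later)) = no-sink (suc i) λ j →
        (λ e → up-towards j (later j (subst (λ t → toℕ t ≤ toℕ j) e (parent< j)))) ,
        (λ { refl → away })

theorem4p1 : ∀ {n : ℕ} (G : Graph n) (k : ℕ) → 0 < k →
    (F* : List (OSep G) → Set) → IsUncrossing G k F* →
    (HasBlock G k ⊎ HasTree G k F*) × ¬ (HasBlock G k × HasTree G k F*)
theorem4p1 G k _ F* unc =
  [ inj₁ , inj₂ ∘ contradictory⇒tree G k F* unc ]′ (block⊎light-contradictory G k F* unc) ,
  λ ((I , k≤I , insep , _) , T) → block⇒¬tree G k F* unc k≤I insep T
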